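{- Let $p$ be a constant with $\tfrac12(\sqrt5-1) < p < 1$. Inserting a converging sequence, or more generally any finger sequence, of $n$ elements into an initially empty binary search tree, applying \textsc{RebalanceZigZag} after each insertion, results in a binary search tree in which every node has expected depth $O(\lg n)$.
   Context: A finger sequence is a sequence of distinct keys such that each key after the first is, among all keys inserted so far, the immediate predecessor or the immediate successor of the most recently inserted key. The converging sequence (for $n$ even) is $1, n, 2, n-1, 3, n-2, \ldots, n/2, n/2+1$; increasing and decreasing sequences are also finger sequences. Each new element is first placed as a new leaf $v$ at its standard unbalanced BST position, and then \textsc{RebalanceZigZag}$(v)$ is applied: while $v$ has a parent and an independent coin flip shows tail (tail has probability $p$, head probability $1-p$), set $v\gets$ parent of $v$. Afterwards, if $v$ has a parent and a grandparent: if $v$ and its parent are both left children or both right children, rotate the parent of $v$ up once; otherwise rotate $v$ up twice. ("Rotating $x$ up" is the standard single rotation at the parent of $x$ that moves $x$ one level up.) The depth of a node is the number of edges from it to the root. Expectation is over the coin flips.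
   Formalization: The constant p is taken to be rational, with ½(√5−1) < p < 1 expressed as p > 0, p² + p > 1 and p < 1; the English allows any real p in this interval. -}

module Defs where

open import Data.Nat as ℕ using (ℕ; zero; suc; _<ᵇ_)
open import Data.Bool using (Bool; true; false; if_then_else_)
open import Data.List using (List; []; _∷_; _++_; map; concatMap; foldr)
open import Data.List.Membership.Propositional using (_∈_)
open import Data.List.Relation.Unary.Unique.Propositional using (Unique)
open import Data.Product using (_×_; _,_)
open import Data.Integer using (+_)
open import Data.Rational using (ℚ; 0ℚ; 1ℚ; _+_; _*_; _-_; _/_)
open import Relation.Binary.PropositionalEquality using (_≡_)
open import Relation.Nullary using (¬_)

data Tree : Set where
  leaf : Tree
  node : Tree → ℕ → Tree → Tree

-- Zipper frames: the focus is the left child (goL x r) of a node with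
-- key x and right subtree r, or the right child (goR l x).
data Frame : Set where
  goL : ℕ → Tree → Frame
  goR : Tree → ℕ → Frame

-- Context: innermost frame (parent) first.
Ctx : Set
Ctx = List Frame

plugFrame : Frame → Tree → Tree
plugFrame (goL x r) t = node t x r
plugFrame (goR l x) t = node l x t

plug : Ctx → Tree → Tree
plug [] t = t
plug (f ∷ fs) t = plug fs (plugFrame f t)

-- Standard unbalanced BST leaf insertion, returning the path to the new
-- leaf v = node leaf k leaf (the context) with v in focus.
-- (If k is already present, the focus is the existing node; this never
-- happens for sequences of distinct keys.)
insertZ : ℕ → Ctx → Tree → Ctx × Tree
insertZ k c leaf = c , node leaf k leaf
insertZ k c (node l x r) =
  if k <ᵇ x then insertZ k (goL x r ∷ c) l
  else if x <ᵇ k then insertZ k (goR l x ∷ c) r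
  else (c , node l x r)

-- The rotation step of RebalanceZigZag at the final node v (in focus):
-- if v has a parent and a grandparent, a zig-zig rotates the parent up
-- once, a zig-zag rotates v up twice; the tree is then reassembled.
finish : Ctx → Tree → Tree
finish (goL x r ∷ goL y s ∷ fs) t = plug fs (node t x (node r y s))
finish (goR l x ∷ goR l' y ∷ fs) t = plug fs (node (node l' y l) x t)
finish (goL x r ∷ goR l y ∷ fs) (node a v b) = plug fs (node (node l y a) v (node b x r))
finish (goR l x ∷ goL y r ∷ fs) (node a v b) = plug fs (node (node l x a) v (node b y r))
finish c t = plug c t

Dist : Set → Set
Dist A = List (ℚ × A)

scale : {A : Set} → ℚ → Dist A → Dist A
scale q = map (λ { (w , a) → (q * w , a) })

-- The climbing loop of RebalanceZigZag, started with focus v and context c: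
-- while v has a parent, with probability 1-p (head) stop and finish,
-- with probability p (tail) move v to its parent.  At the root the loop
-- stops (no coin flip), and finish does nothing.
climb : ℚ → Ctx → Tree → Dist Tree
climb p [] t = (1ℚ , t) ∷ []
climb p (f ∷ fs) t =
  ((1ℚ - p) , finish (f ∷ fs) t) ∷ scale p (climb p fs (plugFrame f t))

insertRebalance : ℚ → ℕ → Tree → Dist Tree
insertRebalance p k t with insertZ k [] t
... | c , v = climb p c v

bind : {A B : Set} → Dist A → (A → Dist B) → Dist B
bind d f = concatMap (λ { (w , a) → scale w (f a) }) d

insertAll : ℚ → List ℕ → Tree → Dist Tree
insertAll p [] t = (1ℚ , t) ∷ []
insertAll p (x ∷ xs) t = bind (insertRebalance p x t) (insertAll p xs)

run : ℚ → List ℕ → Dist Tree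
run p xs = insertAll p xs leaf

-- Depth (number of edges to the root) of key k; 0 if k is absent
-- (only used for keys that are present).
depth : ℕ → Tree → ℕ
depth k leaf = 0
depth k (node l x r) =
  if k <ᵇ x then suc (depth k l)
  else if x <ᵇ k then suc (depth k r)
  else 0

ℕtoℚ : ℕ → ℚ
ℕtoℚ n = (+ n) / 1

expectation : {A : Set} → (A → ℚ) → Dist A → ℚ
expectation f = foldr (λ { (w , a) acc → w * f a + acc }) 0ℚ

expectedDepth : ℚ → List ℕ → ℕ → ℚ
expectedDepth p xs k = expectation (λ t → ℕtoℚ (depth k t)) (run p xs)

StrictlyBetween : ℕ → ℕ → ℕ → Set
StrictlyBetween a b c = (a ℕ.< c × c ℕ.< b) ⊎' (b ℕ.< c × c ℕ.< a)
  where
  open import Data.Sum renaming (_⊎_ to _⊎'_)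

-- Finger sequence: distinct keys, and each key b following a key a is the
-- immediate predecessor or successor of a among the keys inserted so far,
-- i.e. no earlier key lies strictly between a and b.
record FingerSeq (xs : List ℕ) : Set where
  field
    distinct : Unique xs
    finger   : ∀ pre a b suf → xs ≡ pre ++ a ∷ b ∷ suf →
               ∀ c → c ∈ pre → ¬ StrictlyBetween a b c

{-# OPTIONS --safe #-}
module Submission where

-- Let b be the key inserted next and m the depth of the gap that receives it. All later keys fall
-- into this gap, and a rotation shortens the search path to it by exactly one. Hence an insertion
-- leaves m unchanged, except with probability q(m) = p^(m-1) (the climb stops at depth at most one
-- and nothing is rotated), when m grows by one. For an arbitrary key k whose search path leaves the
-- path to b at depth e, a rotation at the nodes of depth e, e+1, e+2 moves k down by one, and every
-- rotation further up moves it up by one; when p² + p ≥ 1 the expected change is at most q(m), the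
-- expected growth of m. So depth k + max(0, L - m) increases by at most q(L) per insertion in
-- expectation, and the expected depth after n insertions is at most L + n q(L) + 1. Taking L
-- proportional to log n makes n q(L) at most 1.

open import Defs
open import Data.Nat using (ℕ; _≤_)
open import Data.Nat.Logarithm using (⌊log₂_⌋)
open import Data.List using (List; length)
open import Data.List.Membership.Propositional using (_∈_)
open import Data.Product using (Σ-syntax)
open import Data.Rational using (ℚ; 0ℚ; 1ℚ; _<_; _+_; _*_) renaming (_≤_ to _≤ℚ_)

import Data.Nat as ℕ
import Data.Nat.Properties as ℕ
import Data.Integer as ℤ
import Data.Integer.Properties as ℤ
import Data.Nat.Coprimality as Coprimality
import Data.Rational as ℚ
import Data.Rational.Properties as ℚ
import Data.Rational.Unnormalised as ℚᵘ
import Data.Rational.Unnormalised.Properties as ℚᵘ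
open import Data.Bool using (true; false)
open import Data.Empty using (⊥-elim)
open import Data.List using ([]; _∷_; _++_)
open import Data.List.Properties using (++-assoc)
open import Data.List.Membership.Propositional.Properties using (∈-++⁺ˡ; ∈-++⁺ʳ)
open import Data.List.Relation.Unary.All as All using (All; []; _∷_)
open import Data.List.Relation.Unary.All.Properties using (map⁺)
open import Data.List.Relation.Unary.Any using (here; there)
open import Data.List.Relation.Unary.AllPairs using (_∷_)
open import Data.List.Relation.Unary.Unique.Propositional using (Unique)
open import Data.Nat.Logarithm using (⌊log₂⌋-mono-≤; ⌊log₂[2^n]⌋≡n)
open import Data.Nat using (zero; suc; z≤n; s≤s; _∸_; _<ᵇ_)
open import Data.Nat.Solver using () renaming (module +-*-Solver to ℕ-Solver)
open import Data.Product using (_×_; _,_; proj₁; proj₂)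
open import Data.Rational using (_-_)
open import Data.Rational.Solver using (module +-*-Solver)
open import Data.Sum using (_⊎_; inj₁; inj₂)
open import Data.Unit using (⊤; tt)
open import Relation.Binary.Definitions using (tri<; tri≈; tri>)
open import Relation.Binary.PropositionalEquality
  using (_≡_; _≢_; refl; sym; trans; cong; cong₂; subst; module ≡-Reasoning)
open import Relation.Nullary using (¬_; Dec; yes; no)
open import Relation.Nullary.Decidable using (dec-true; dec-false)

-- Search trees

AllKeys : (ℕ → Set) → Tree → Set
AllKeys P leaf         = ⊤
AllKeys P (node l x r) = AllKeys P l × P x × AllKeys P r

AllKeys-map : ∀ {P Q : ℕ → Set} → (∀ {x} → P x → Q x) → ∀ t → AllKeys P t → AllKeys Q t
AllKeys-map h leaf         _            = tt
AllKeys-map h (node l x r) (pl , px , pr) = AllKeys-map h l pl , h px , AllKeys-map h r pr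

BST : Tree → Set
BST leaf         = ⊤
BST (node l x r) = BST l × AllKeys (ℕ._< x) l × AllKeys (x ℕ.<_) r × BST r

-- The inequalities are strict because a search that meets its own key ends there and never enters
-- the hole.
Fit : ℕ → Frame → Set
Fit k (goL x r) = k ℕ.< x
Fit k (goR l x) = x ℕ.< k

Fit? : ∀ k f → Dec (Fit k f)
Fit? k (goL x r) = k ℕ.<? x
Fit? k (goR l x) = x ℕ.<? k

-- k fits c when searching for k in plug c t reaches the focus t.
Fits : ℕ → Ctx → Set
Fits k = All (Fit k)

module _ {k x : ℕ} (l r : Tree) where

  depth-< : k ℕ.< x → depth k (node l x r) ≡ suc (depth k l)
  depth-< k<x rewrite dec-true (k ℕ.<? x) k<x = refl

  depth-> : x ℕ.< k → depth k (node l x r) ≡ suc (depth k r)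
  depth-> x<k rewrite dec-false (k ℕ.<? x) (ℕ.<-asym x<k) | dec-true (x ℕ.<? k) x<k = refl

depth-≡ : ∀ k l r → depth k (node l k r) ≡ 0
depth-≡ k l r rewrite dec-false (k ℕ.<? k) (ℕ.<-irrefl refl) = refl

≮⇒>⊎≡ : ∀ {m n} → ¬ m ℕ.< n → n ℕ.< m ⊎ n ≡ m
≮⇒>⊎≡ m≮n = ℕ.m≤n⇒m<n∨m≡n (ℕ.≮⇒≥ m≮n)

depth-plugFrame : ∀ {k} f t → Fit k f → depth k (plugFrame f t) ≡ suc (depth k t)
depth-plugFrame (goL x r) t k<x = depth-< t r k<x
depth-plugFrame (goR l x) t x<k = depth-> l t x<k

depth-plugFrame-side : ∀ {k} f t t' → ¬ Fit k f → depth k (plugFrame f t) ≡ depth k (plugFrame f t')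
depth-plugFrame-side (goL x r) t t' k≮x with ≮⇒>⊎≡ k≮x
... | inj₁ x<k  = trans (depth-> t r x<k) (sym (depth-> t' r x<k))
... | inj₂ refl = trans (depth-≡ x t r) (sym (depth-≡ x t' r))
depth-plugFrame-side (goR l x) t t' x≮k with ≮⇒>⊎≡ x≮k
... | inj₁ k<x  = trans (depth-< l t k<x) (sym (depth-< l t' k<x))
... | inj₂ refl = trans (depth-≡ x l t) (sym (depth-≡ x l t'))

depth-plug : ∀ {k} c t → Fits k c → depth k (plug c t) ≡ length c ℕ.+ depth k t
depth-plug []      t []       = refl
depth-plug {k} (f ∷ c) t (h ∷ hs) = begin
  depth k (plug c (plugFrame f t))           ≡⟨ depth-plug c (plugFrame f t) hs ⟩
  length c ℕ.+ depth k (plugFrame f t)       ≡⟨ cong (length c ℕ.+_) (depth-plugFrame f t h) ⟩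
  length c ℕ.+ suc (depth k t)               ≡⟨ ℕ.+-suc (length c) (depth k t) ⟩
  suc (length c ℕ.+ depth k t)               ∎
  where open ≡-Reasoning

-- The search leaves the path to the hole at the outermost frame that `k` does not fit, so it never
-- sees the plugged tree. The recursion moves inner frames into the plugged tree until that frame is
-- the innermost one left.
depth-plug-side : ∀ {k} c t t' → ¬ Fits k c → depth k (plug c t) ≡ depth k (plug c t')
depth-plug-side [] t t' ¬h = ⊥-elim (¬h [])
depth-plug-side {k} (f ∷ c) t t' ¬h with All.all? (Fit? k) c
... | no ¬hs = depth-plug-side c (plugFrame f t) (plugFrame f t') ¬hs
... | yes hs = begin
  depth k (plug c (plugFrame f t))       ≡⟨ depth-plug c (plugFrame f t) hs ⟩
  length c ℕ.+ depth k (plugFrame f t)   ≡⟨ cong (length c ℕ.+_) (depth-plugFrame-side f t t' (λ h → ¬h (h ∷ hs))) ⟩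
  length c ℕ.+ depth k (plugFrame f t')  ≡⟨ depth-plug c (plugFrame f t') hs ⟨
  depth k (plug c (plugFrame f t'))      ∎
  where open ≡-Reasoning

-- Rotations

-- Isolates the local effect of `finish` on parent frame and grandparent frame, so that depths can
-- be compared without the context above. The last clause mirrors the fallback of `finish` for a
-- zig-zag at an empty focus.
rotate : Frame → Frame → Tree → Tree
rotate (goL x r) (goL y s) t            = node t x (node r y s)
rotate (goR l x) (goR m y) t            = node (node m y l) x t
rotate (goL x r) (goR l y) (node a v b) = node (node l y a) v (node b x r)
rotate (goR l x) (goL y r) (node a v b) = node (node l x a) v (node b y r)
rotate f g leaf                         = plugFrame g (plugFrame f leaf)

finish-rotate : ∀ f g fs t → finish (f ∷ g ∷ fs) t ≡ plug fs (rotate f g t)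
finish-rotate (goL x r) (goL y s) fs t            = refl
finish-rotate (goR l x) (goR m y) fs t            = refl
finish-rotate (goL x r) (goR l y) fs (node a v b) = refl
finish-rotate (goR l x) (goL y r) fs (node a v b) = refl
finish-rotate (goL x r) (goR l y) fs leaf         = refl
finish-rotate (goR l x) (goL y r) fs leaf         = refl

rotate-AllKeys : ∀ {P} f g t → AllKeys P (plugFrame g (plugFrame f t)) → AllKeys P (rotate f g t)
rotate-AllKeys (goL x r) (goL y s) t ((pt , px , pr) , py , ps) = pt , px , pr , py , ps
rotate-AllKeys (goR l x) (goR m y) t (pm , py , (pl , px , pt)) = (pm , py , pl) , px , pt
rotate-AllKeys (goL x r) (goR l y) (node a v b) (pl , py , ((pa , pv , pb) , px , pr)) =
  (pl , py , pa) , pv , (pb , px , pr)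
rotate-AllKeys (goR l x) (goL y r) (node a v b) ((pl , px , (pa , pv , pb)) , py , pr) =
  (pl , px , pa) , pv , (pb , py , pr)
rotate-AllKeys (goL x r) (goR l y) leaf h = h
rotate-AllKeys (goR l x) (goL y r) leaf h = h

keys-<-trans : ∀ {x y} t → x ℕ.< y → AllKeys (ℕ._< x) t → AllKeys (ℕ._< y) t
keys-<-trans t x<y = AllKeys-map (λ z<x → ℕ.<-trans z<x x<y) t

keys->-trans : ∀ {x y} t → x ℕ.< y → AllKeys (y ℕ.<_) t → AllKeys (x ℕ.<_) t
keys->-trans t x<y = AllKeys-map (ℕ.<-trans x<y) t

rotate-BST : ∀ f g t → BST (plugFrame g (plugFrame f t)) → BST (rotate f g t)
rotate-BST (goL x r) (goL y s) t ((bt , t<x , x<r , br) , (t<y , x<y , r<y) , y<s , bs) =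
  bt , t<x , (x<r , x<y , keys->-trans s x<y y<s) , (br , r<y , y<s , bs)
rotate-BST (goR l x) (goR m y) t (bm , m<y , (y<l , y<x , y<t) , (bl , l<x , x<t , bt)) =
  (bm , m<y , y<l , bl) , (keys-<-trans m y<x m<y , y<x , l<x) , x<t , bt
rotate-BST (goL x r) (goR l y) (node a v b)
  (bl , l<y , ((y<a , y<v , y<b) , y<x , y<r) , ((ba , a<v , v<b , bb) , (a<x , v<x , b<x) , x<r , br)) =
  (bl , l<y , y<a , ba) , (keys-<-trans l y<v l<y , y<v , a<v) ,
  (v<b , v<x , keys->-trans r v<x x<r) , (bb , b<x , x<r , br)
rotate-BST (goR l x) (goL y r) (node a v b)
  ((bl , l<x , (x<a , x<v , x<b) , (ba , a<v , v<b , bb)) , (l<y , x<y , (a<y , v<y , b<y)) , y<r , br) =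
  (bl , l<x , x<a , ba) , (keys-<-trans l x<v l<x , x<v , a<v) ,
  (v<b , v<y , keys->-trans r v<y y<r) , (bb , b<y , y<r , br)
rotate-BST (goL x r) (goR l y) leaf h = h
rotate-BST (goR l x) (goL y r) leaf h = h

data IsNode : Tree → Set where
  isNode : ∀ {l x r} → IsNode (node l x r)

data RootNot (k : ℕ) : Tree → Set where
  rootNot : ∀ {l x r} → k ≢ x → RootNot k (node l x r)

plugFrame-isNode : ∀ f t → IsNode (plugFrame f t)
plugFrame-isNode (goL x r) t = isNode
plugFrame-isNode (goR l x) t = isNode

plugFrame-rootNot : ∀ {k} f t → Fit k f → RootNot k (plugFrame f t)
plugFrame-rootNot (goL x r) t k<x = rootNot (ℕ.<⇒≢ k<x)
plugFrame-rootNot (goR l x) t x<k = rootNot (ℕ.>⇒≢ x<k)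

module _ {k : ℕ} where

  -- A zig-zig raises the whole focus by one. A zig-zag raises the root of the focus by two, but its
  -- two subtrees, which end up below the old parent and grandparent, by only one; `RootNot` sends
  -- the search for `k` into one of these subtrees.
  rotate-depth-below : ∀ f g {t} → RootNot k t → Fit k f → Fit k g →
    suc (depth k (rotate f g t)) ≡ depth k (plugFrame g (plugFrame f t))
  rotate-depth-below (goL x r) (goL y s) {t} _ k<x k<y
    rewrite depth-< (node t x r) s k<y | depth-< t r k<x | depth-< t (node r y s) k<x = refl
  rotate-depth-below (goR l x) (goR m y) {t} _ x<k y<k
    rewrite depth-> m (node l x t) y<k | depth-> l t x<k | depth-> (node m y l) t x<k = refl
  rotate-depth-below (goL x r) (goR l y) {node a v b} (rootNot k≢v) k<x y<k
    rewrite depth-> l (node (node a v b) x r) y<k | depth-< (node a v b) r k<x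
    with ℕ.<-cmp k v
  ... | tri< k<v _ _
    rewrite depth-< (node l y a) (node b x r) k<v | depth-> l a y<k | depth-< a b k<v = refl
  ... | tri≈ _ k≡v _ = ⊥-elim (k≢v k≡v)
  ... | tri> _ _ v<k
    rewrite depth-> (node l y a) (node b x r) v<k | depth-< b r k<x | depth-> a b v<k = refl
  rotate-depth-below (goR l x) (goL y r) {node a v b} (rootNot k≢v) x<k k<y
    rewrite depth-< (node l x (node a v b)) r k<y | depth-> l (node a v b) x<k
    with ℕ.<-cmp k v
  ... | tri< k<v _ _
    rewrite depth-< (node l x a) (node b y r) k<v | depth-> l a x<k | depth-< a b k<v = refl
  ... | tri≈ _ k≡v _ = ⊥-elim (k≢v k≡v)
  ... | tri> _ _ v<k
    rewrite depth-> (node l x a) (node b y r) v<k | depth-< b r k<y | depth-> a b v<k = refl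

  -- Only an inequality, since `k` may be the root of the focus: that node moves from depth two to
  -- depth one in a zig-zig and to depth zero in a zig-zag.
  rotate-depth-focus : ∀ f g {t} → IsNode t → Fit k f → Fit k g →
    suc (depth k (rotate f g t)) ≤ depth k (plugFrame g (plugFrame f t))
  rotate-depth-focus f g {node a v b} isNode hf hg with k ℕ.≟ v
  ... | no  k≢v  = ℕ.≤-reflexive (rotate-depth-below f g (rootNot k≢v) hf hg)
  ... | yes refl
    rewrite depth-plugFrame g (plugFrame f (node a k b)) hg | depth-plugFrame f (node a k b) hf
          | depth-≡ k a b = s≤s (root f g hf)
    where
    root : ∀ f g → Fit k f → depth k (rotate f g (node a k b)) ≤ 1
    root (goL x r) (goL y s) k<x rewrite depth-< (node a k b) (node r y s) k<x | depth-≡ k a b = s≤s z≤n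
    root (goR l x) (goR m y) x<k rewrite depth-> (node m y l) (node a k b) x<k | depth-≡ k a b = s≤s z≤n
    root (goL x r) (goR l y) _   rewrite depth-≡ k (node l y a) (node b x r) = z≤n
    root (goR l x) (goL y r) _   rewrite depth-≡ k (node l x a) (node b y r) = z≤n

  -- The outer subtree of the parent keeps its depth in both kinds of rotation. The parent itself
  -- rises by one in a zig-zig and stays at depth one in a zig-zag. In the zig-zag, the search tree
  -- order directs the search past the new root.
  rotate-depth-parent : ∀ f g {t} → BST (plugFrame g (plugFrame f t)) → ¬ Fit k f → Fit k g →
    depth k (rotate f g t) ≤ depth k (plugFrame g (plugFrame f t))
  rotate-depth-parent (goL x r) (goL y s) {t} _ k≮x k<y
    rewrite depth-< (node t x r) s k<y with ≮⇒>⊎≡ k≮x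
  ... | inj₁ x<k
    rewrite depth-> t r x<k | depth-> t (node r y s) x<k | depth-< r s k<y = ℕ.≤-refl
  ... | inj₂ refl rewrite depth-≡ x t (node r y s) = z≤n
  rotate-depth-parent (goR l x) (goR m y) {t} _ x≮k y<k
    rewrite depth-> m (node l x t) y<k with ≮⇒>⊎≡ x≮k
  ... | inj₁ k<x
    rewrite depth-< l t k<x | depth-< (node m y l) t k<x | depth-> m l y<k = ℕ.≤-refl
  ... | inj₂ refl rewrite depth-≡ k (node m y l) t = z≤n
  rotate-depth-parent (goL x r) (goR l y) {node a v b} (_ , _ , _ , (_ , (_ , v<x , _) , _)) k≮x y<k
    rewrite depth-> l (node (node a v b) x r) y<k with ≮⇒>⊎≡ k≮x
  ... | inj₁ x<k
    rewrite depth-> (node l y a) (node b x r) (ℕ.<-trans v<x x<k)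
          | depth-> b r x<k | depth-> (node a v b) r x<k = ℕ.≤-refl
  ... | inj₂ refl
    rewrite depth-> (node l y a) (node b x r) v<x | depth-≡ x b r = s≤s z≤n
  rotate-depth-parent (goR l x) (goL y r) {node a v b} ((_ , _ , (_ , x<v , _) , _) , _) x≮k k<y
    rewrite depth-< (node l x (node a v b)) r k<y with ≮⇒>⊎≡ x≮k
  ... | inj₁ k<x
    rewrite depth-< (node l x a) (node b y r) (ℕ.<-trans k<x x<v)
          | depth-< l a k<x | depth-< l (node a v b) k<x = ℕ.≤-refl
  ... | inj₂ refl
    rewrite depth-< (node l x a) (node b y r) x<v | depth-≡ x l a = s≤s z≤n
  rotate-depth-parent (goL x r) (goR l y) {leaf} _ _ _ = ℕ.≤-refl
  rotate-depth-parent (goR l x) (goL y r) {leaf} _ _ _ = ℕ.≤-refl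

  -- The rotation puts a new root above the grandparent, which sinks by one together with its outer
  -- subtree.
  rotate-depth-grandparent : ∀ f g {t} → BST (plugFrame g (plugFrame f t)) → ¬ Fit k g →
    depth k (rotate f g t) ≤ suc (depth k (plugFrame g (plugFrame f t)))
  rotate-depth-grandparent (goL x r) (goL y s) {t} (_ , (_ , x<y , _) , _) k≮y with ≮⇒>⊎≡ k≮y
  ... | inj₁ y<k
    rewrite depth-> (node t x r) s y<k | depth-> t (node r y s) (ℕ.<-trans x<y y<k)
          | depth-> r s y<k = ℕ.≤-refl
  ... | inj₂ refl
    rewrite depth-> t (node r y s) x<y | depth-≡ y r s = s≤s z≤n
  rotate-depth-grandparent (goR l x) (goR m y) {t} (_ , _ , (_ , y<x , _) , _) y≮k with ≮⇒>⊎≡ y≮k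
  ... | inj₁ k<y
    rewrite depth-< m (node l x t) k<y | depth-< (node m y l) t (ℕ.<-trans k<y y<x)
          | depth-< m l k<y = ℕ.≤-refl
  ... | inj₂ refl
    rewrite depth-< (node m y l) t y<x | depth-≡ y m l = s≤s z≤n
  rotate-depth-grandparent (goL x r) (goR l y) {node a v b} (_ , _ , ((_ , y<v , _) , _) , _) y≮k with ≮⇒>⊎≡ y≮k
  ... | inj₁ k<y
    rewrite depth-< l (node (node a v b) x r) k<y
          | depth-< (node l y a) (node b x r) (ℕ.<-trans k<y y<v) | depth-< l a k<y = ℕ.≤-refl
  ... | inj₂ refl
    rewrite depth-< (node l y a) (node b x r) y<v | depth-≡ y l a = s≤s z≤n
  rotate-depth-grandparent (goR l x) (goL y r) {node a v b} (_ , (_ , _ , (_ , v<y , _)) , _) k≮y with ≮⇒>⊎≡ k≮y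
  ... | inj₁ y<k
    rewrite depth-> (node l x (node a v b)) r y<k
          | depth-> (node l x a) (node b y r) (ℕ.<-trans v<y y<k) | depth-> b r y<k = ℕ.≤-refl
  ... | inj₂ refl
    rewrite depth-> (node l x a) (node b y r) v<y | depth-≡ y b r = s≤s z≤n
  rotate-depth-grandparent (goL x r) (goR l y) {leaf} _ _ = ℕ.n≤1+n _
  rotate-depth-grandparent (goR l x) (goL y r) {leaf} _ _ = ℕ.n≤1+n _

-- Search tree invariants under replacement of the focus

plug-AllKeys⁻ : ∀ {P} c t → AllKeys P (plug c t) → AllKeys P t
plug-AllKeys⁻ []            t h = h
plug-AllKeys⁻ (goL x r ∷ c) t h = proj₁ (plug-AllKeys⁻ c (node t x r) h)
plug-AllKeys⁻ (goR l x ∷ c) t h = proj₂ (proj₂ (plug-AllKeys⁻ c (node l x t) h))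

plug-BST⁻ : ∀ c t → BST (plug c t) → BST t
plug-BST⁻ []            t h = h
plug-BST⁻ (goL x r ∷ c) t h = proj₁ (plug-BST⁻ c (node t x r) h)
plug-BST⁻ (goR l x ∷ c) t h = proj₂ (proj₂ (proj₂ (plug-BST⁻ c (node l x t) h)))

module _ {b : ℕ} where

  infix 4 _⊆+b_

  -- Inclusion of key sets up to the extra key `b`, stated through all predicates at once so that it
  -- applies directly to the bounds `AllKeys` inside `BST`.
  _⊆+b_ : Tree → Tree → Set₁
  s' ⊆+b s = ∀ {P} → P b → AllKeys P s → AllKeys P s'

  plugFrame-⊆+b : ∀ f {s s'} → s' ⊆+b s → plugFrame f s' ⊆+b plugFrame f s
  plugFrame-⊆+b (goL x r) h pb (ps , px , pr) = h pb ps , px , pr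
  plugFrame-⊆+b (goR l x) h pb (pl , px , ps) = pl , px , h pb ps

  plug-⊆+b : ∀ c {s s'} → s' ⊆+b s → plug c s' ⊆+b plug c s
  plug-⊆+b []      h = h
  plug-⊆+b (f ∷ c) h = plug-⊆+b c (plugFrame-⊆+b f h)

  plugFrame-BST : ∀ f {s s'} → Fit b f → s' ⊆+b s → (BST s → BST s') → BST (plugFrame f s) → BST (plugFrame f s')
  plugFrame-BST (goL x r) b<x h g (bs , s<x , x<r , br) = g bs , h b<x s<x , x<r , br
  plugFrame-BST (goR l x) x<b h g (bl , l<x , x<s , bs) = bl , l<x , h x<b x<s , g bs

  plug-BST : ∀ c {s s'} → Fits b c → s' ⊆+b s → (BST s → BST s') → BST (plug c s) → BST (plug c s')
  plug-BST []      []       h g = g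
  plug-BST (f ∷ c) (hf ∷ hc) h g = plug-BST c hc (plugFrame-⊆+b f h) (plugFrame-BST f hf h g)

  -- Freshness of `b` excludes the branch where the descent stops at an existing node, so it runs
  -- until it meets an empty gap.
  insertZ-leaf : ∀ c t → AllKeys (_≢ b) t → Fits b c →
    Σ[ c' ∈ Ctx ] (insertZ b c t ≡ (c' , node leaf b leaf) × plug c' leaf ≡ plug c t × Fits b c')
  insertZ-leaf c leaf _ hc = c , refl , refl , hc
  insertZ-leaf c (node l x r) (l≢b , x≢b , r≢b) hc with ℕ.<-cmp b x
  ... | tri< b<x _ _ rewrite dec-true (b ℕ.<? x) b<x = insertZ-leaf (goL x r ∷ c) l l≢b (b<x ∷ hc)
  ... | tri≈ _ b≡x _ = ⊥-elim (x≢b (sym b≡x))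
  ... | tri> b≮x _ x<b rewrite dec-false (b ℕ.<? x) b≮x | dec-true (x ℕ.<? b) x<b =
    insertZ-leaf (goR l x ∷ c) r r≢b (x<b ∷ hc)

  finish-BST-AllKeys : ∀ {P} c t → Fits b c → P b → BST (plug c t) → AllKeys P (plug c t) →
    BST (finish c t) × AllKeys P (finish c t)
  finish-BST-AllKeys []             t _ _ bst keys = bst , keys
  finish-BST-AllKeys (goL x r ∷ []) t _ _ bst keys = bst , keys
  finish-BST-AllKeys (goR l x ∷ []) t _ _ bst keys = bst , keys
  finish-BST-AllKeys (f ∷ g ∷ c) t (_ ∷ _ ∷ hc) pb bst keys rewrite finish-rotate f g c t =
    plug-BST c hc rotated (rotate-BST f g t) bst , plug-⊆+b c rotated pb keys
    where
    rotated : rotate f g t ⊆+b plugFrame g (plugFrame f t)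
    rotated _ = rotate-AllKeys f g t

-- The two assumptions say that no key satisfying `P` that differs from `b` separates `b` from `b'`,
-- so each comparison on the path has the same outcome for both. This carries the gap of one
-- inserted key over to the next.
Fits-transfer : ∀ {P b b'} → (∀ {x} → P x → b ℕ.< x → b' ℕ.< x) → (∀ {x} → P x → x ℕ.< b → x ℕ.< b') →
  ∀ c t → AllKeys P (plug c t) → Fits b c → Fits b' c
Fits-transfer up down []      t keys []        = []
Fits-transfer up down (goL x r ∷ c) t keys (h ∷ hs) =
  up (proj₁ (proj₂ (plug-AllKeys⁻ c (node t x r) keys))) h ∷ Fits-transfer up down c (node t x r) keys hs
Fits-transfer up down (goR l x ∷ c) t keys (h ∷ hs) =
  down (proj₁ (proj₂ (plug-AllKeys⁻ c (node l x t) keys))) h ∷ Fits-transfer up down c (node l x t) keys hs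

-- Depth changes in the whole tree caused by one rotation

module _ {k : ℕ} (f g : Frame) (c : Ctx) {t : Tree} where

  private
    d d' : ℕ
    d  = depth k (finish (f ∷ g ∷ c) t)
    d' = depth k (plug (f ∷ g ∷ c) t)

    d≡ : Fits k c → d ≡ length c ℕ.+ depth k (rotate f g t)
    d≡ hc = trans (cong (depth k) (finish-rotate f g c t)) (depth-plug c (rotate f g t) hc)

    d'≡ : Fits k c → d' ≡ length c ℕ.+ depth k (plugFrame g (plugFrame f t))
    d'≡ hc = depth-plug c (plugFrame g (plugFrame f t)) hc

  finish-depth-below : RootNot k t → Fits k (f ∷ g ∷ c) → suc d ≡ d'
  finish-depth-below root (hf ∷ hg ∷ hc) rewrite d≡ hc | d'≡ hc =
    trans (sym (ℕ.+-suc (length c) _)) (cong (length c ℕ.+_) (rotate-depth-below f g root hf hg))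

  finish-depth-focus : IsNode t → Fits k (f ∷ g ∷ c) → suc d ≤ d'
  finish-depth-focus root (hf ∷ hg ∷ hc) rewrite d≡ hc | d'≡ hc | sym (ℕ.+-suc (length c) (depth k (rotate f g t))) =
    ℕ.+-monoʳ-≤ (length c) (rotate-depth-focus f g root hf hg)

  finish-depth-parent : BST (plug (f ∷ g ∷ c) t) → ¬ Fit k f → Fits k (g ∷ c) → d ≤ d'
  finish-depth-parent bst ¬hf (hg ∷ hc) rewrite d≡ hc | d'≡ hc =
    ℕ.+-monoʳ-≤ (length c) (rotate-depth-parent f g (plug-BST⁻ c _ bst) ¬hf hg)

  finish-depth-grandparent : BST (plug (f ∷ g ∷ c) t) → ¬ Fit k g → Fits k c → d ≤ suc d'
  finish-depth-grandparent bst ¬hg hc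
    rewrite d≡ hc | d'≡ hc | sym (ℕ.+-suc (length c) (depth k (plugFrame g (plugFrame f t)))) =
    ℕ.+-monoʳ-≤ (length c) (rotate-depth-grandparent f g (plug-BST⁻ c _ bst) ¬hg)

  finish-depth-above : ¬ Fits k c → d ≡ d'
  finish-depth-above ¬hc = trans (cong (depth k) (finish-rotate f g c t)) (depth-plug-side c _ _ ¬hc)

finish-single : ∀ f t → finish (f ∷ []) t ≡ plugFrame f t
finish-single (goL x r) t = refl
finish-single (goR l x) t = refl

-- Rational arithmetic

ℕtoℚ-mkℚ : ∀ n → ℕtoℚ n ≡ ℚ.mkℚ (ℤ.+ n) 0 (Coprimality.sym (Coprimality.1-coprimeTo n))
ℕtoℚ-mkℚ n = ℚ.normalize-coprime (Coprimality.sym (Coprimality.1-coprimeTo n))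

ℕtoℚ-+ : ∀ m n → ℕtoℚ (m ℕ.+ n) ≡ ℕtoℚ m + ℕtoℚ n
ℕtoℚ-+ m n rewrite ℕtoℚ-mkℚ m | ℕtoℚ-mkℚ n =
  cong (ℚ._/ 1) (sym (cong₂ ℤ._+_ (ℤ.*-identityʳ (ℤ.+ m)) (ℤ.*-identityʳ (ℤ.+ n))))

ℕtoℚ-* : ∀ m n → ℕtoℚ (m ℕ.* n) ≡ ℕtoℚ m * ℕtoℚ n
ℕtoℚ-* m n rewrite ℕtoℚ-mkℚ m | ℕtoℚ-mkℚ n = cong (ℚ._/ 1) (ℤ.pos-* m n)

ℕtoℚ-nonNeg : ∀ n → 0ℚ ≤ℚ ℕtoℚ n
ℕtoℚ-nonNeg n = ℚ.nonNegative⁻¹ (ℕtoℚ n) {{ℚ.normalize-nonNeg n 1}}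

ℕtoℚ-suc : ∀ n → ℕtoℚ (suc n) ≡ 1ℚ + ℕtoℚ n
ℕtoℚ-suc = ℕtoℚ-+ 1

ℕtoℚ-mono-≤ : ∀ {m n} → m ≤ n → ℕtoℚ m ≤ℚ ℕtoℚ n
ℕtoℚ-mono-≤ {m} {n} m≤n = begin
  ℕtoℚ m                   ≡⟨ ℚ.+-identityʳ (ℕtoℚ m) ⟨
  ℕtoℚ m + 0ℚ              ≤⟨ ℚ.+-monoʳ-≤ (ℕtoℚ m) (ℕtoℚ-nonNeg (n ∸ m)) ⟩
  ℕtoℚ m + ℕtoℚ (n ∸ m)    ≡⟨ ℕtoℚ-+ m (n ∸ m) ⟨
  ℕtoℚ (m ℕ.+ (n ∸ m))     ≡⟨ cong ℕtoℚ (ℕ.m+[n∸m]≡n m≤n) ⟩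
  ℕtoℚ n                   ∎
  where open ℚ.≤-Reasoning

*-monoˡ-≤ : ∀ {r x y} → 0ℚ ≤ℚ r → x ≤ℚ y → r * x ≤ℚ r * y
*-monoˡ-≤ {r} 0≤r = ℚ.*-monoˡ-≤-nonNeg r {{ℚ.nonNegative 0≤r}}

*-monoʳ-≤ : ∀ {r x y} → 0ℚ ≤ℚ r → x ≤ℚ y → x * r ≤ℚ y * r
*-monoʳ-≤ {r} 0≤r = ℚ.*-monoʳ-≤-nonNeg r {{ℚ.nonNegative 0≤r}}

*-nonNeg : ∀ {x y} → 0ℚ ≤ℚ x → 0ℚ ≤ℚ y → 0ℚ ≤ℚ x * y
*-nonNeg {x} 0≤x 0≤y = ℚ.≤-trans (ℚ.≤-reflexive (sym (ℚ.*-zeroʳ x))) (*-monoˡ-≤ 0≤x 0≤y)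

-- Expectations

module _ {A : Set} where

  expectation-scale : ∀ (f : A → ℚ) q d → expectation f (scale q d) ≡ q * expectation f d
  expectation-scale f q []            = sym (ℚ.*-zeroʳ q)
  expectation-scale f q ((w , a) ∷ d) = begin
    q * w * f a + expectation f (scale q d)   ≡⟨ cong (q * w * f a +_) (expectation-scale f q d) ⟩
    q * w * f a + q * expectation f d         ≡⟨ solve 4 (λ q w x e → q :* w :* x :+ q :* e := q :* (w :* x :+ e)) refl q w (f a) (expectation f d) ⟩
    q * (w * f a + expectation f d)           ∎
    where
    open ≡-Reasoning
    open +-*-Solver

  expectation-++ : ∀ (f : A → ℚ) d e → expectation f (d ++ e) ≡ expectation f d + expectation f e
  expectation-++ f []            e = sym (ℚ.+-identityˡ (expectation f e))
  expectation-++ f ((w , a) ∷ d) e =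
    trans (cong (w * f a +_) (expectation-++ f d e)) (sym (ℚ.+-assoc (w * f a) (expectation f d) (expectation f e)))

  expectation-+ : ∀ (f g : A → ℚ) d → expectation (λ a → f a + g a) d ≡ expectation f d + expectation g d
  expectation-+ f g []            = refl
  expectation-+ f g ((w , a) ∷ d) = begin
    w * (f a + g a) + expectation (λ a → f a + g a) d          ≡⟨ cong (w * (f a + g a) +_) (expectation-+ f g d) ⟩
    w * (f a + g a) + (expectation f d + expectation g d)      ≡⟨ solve 5 (λ w x y u v → w :* (x :+ y) :+ (u :+ v) := (w :* x :+ u) :+ (w :* y :+ v)) refl w (f a) (g a) (expectation f d) (expectation g d) ⟩
    (w * f a + expectation f d) + (w * g a + expectation g d)  ∎
    where
    open ≡-Reasoning
    open +-*-Solver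

  expectation-mono : ∀ {f g : A → ℚ} {d} → All (λ wa → 0ℚ ≤ℚ proj₁ wa × f (proj₂ wa) ≤ℚ g (proj₂ wa)) d →
    expectation f d ≤ℚ expectation g d
  expectation-mono []              = ℚ.≤-refl
  expectation-mono ((0≤w , h) ∷ hs) = ℚ.+-mono-≤ (*-monoˡ-≤ 0≤w h) (expectation-mono hs)

expectation-bind : ∀ {A B : Set} (f : B → ℚ) (h : A → Dist B) d →
  expectation f (bind d h) ≡ expectation (λ a → expectation f (h a)) d
expectation-bind f h []            = refl
expectation-bind f h ((w , a) ∷ d) =
  trans (expectation-++ f (scale w (h a)) (bind d h))
        (cong₂ _+_ (expectation-scale f w (h a)) (expectation-bind f h d))

Unique-++-≢ : ∀ {xs ys} {x y : ℕ} → Unique (xs ++ ys) → x ∈ xs → y ∈ ys → x ≢ y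
Unique-++-≢ {_ ∷ xs} (x≢ ∷ _) (here refl) y∈ys = All.lookup x≢ (∈-++⁺ʳ xs y∈ys)
Unique-++-≢ {_ ∷ xs} (_ ∷ u)  (there x∈xs) y∈ys = Unique-++-≢ u x∈xs y∈ys

-- The probability of a climb without rotation, and single coin flips

module RebalanceZigZag (p : ℚ) (0≤p : 0ℚ ≤ℚ p) (p≤1 : p ≤ℚ 1ℚ) (1≤p²+p : 1ℚ ≤ℚ p * p + p) where

  -- The probability that a climb from depth m ends at depth at most one, where nothing is rotated.
  stay : ℕ → ℚ
  stay 0             = 1ℚ
  stay 1             = 1ℚ
  stay (suc (suc m)) = p * stay (suc m)

  stay-nonNeg : ∀ m → 0ℚ ≤ℚ stay m
  stay-nonNeg 0             = ℚ.nonNegative⁻¹ 1ℚ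
  stay-nonNeg 1             = ℚ.nonNegative⁻¹ 1ℚ
  stay-nonNeg (suc (suc m)) = *-nonNeg 0≤p (stay-nonNeg (suc m))

  -- The inequality can be strict only at zero: `stay 1` is 1 rather than `p`, because a climb from
  -- depth one rotates nothing.
  p*stay≤stay : ∀ m → p * stay m ≤ℚ stay (suc m)
  p*stay≤stay zero    = ℚ.≤-trans (ℚ.≤-reflexive (ℚ.*-identityʳ p)) p≤1
  p*stay≤stay (suc m) = ℚ.≤-refl

  stay-suc : ∀ m → stay (suc m) ≤ℚ stay m
  stay-suc zero    = ℚ.≤-refl
  stay-suc (suc m) = ℚ.≤-trans (*-monoʳ-≤ (stay-nonNeg (suc m)) p≤1) (ℚ.≤-reflexive (ℚ.*-identityˡ (stay (suc m))))

  stay-antimono-+ : ∀ m n → stay (n ℕ.+ m) ≤ℚ stay m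
  stay-antimono-+ m zero    = ℚ.≤-refl
  stay-antimono-+ m (suc n) = ℚ.≤-trans (stay-suc (n ℕ.+ m)) (stay-antimono-+ m n)

  stay-antimono : ∀ {m n} → m ≤ n → stay n ≤ℚ stay m
  stay-antimono {m} {n} m≤n = subst (λ i → stay i ≤ℚ stay m) (ℕ.m∸n+n≡m m≤n) (stay-antimono-+ m (n ∸ m))

  -- The mean over one coin flip: `x` on head, where the climb stops, and `y` on tail, where it goes
  -- on.
  mix : ℚ → ℚ → ℚ
  mix x y = (1ℚ - p) * x + p * y

  0≤1-p : 0ℚ ≤ℚ 1ℚ - p
  0≤1-p = ℚ.≤-trans (ℚ.≤-reflexive (sym (ℚ.+-inverseʳ p))) (ℚ.+-monoˡ-≤ (ℚ.- p) p≤1)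

  mix-mono : ∀ {x x' y y'} → x ≤ℚ x' → y ≤ℚ y' → mix x y ≤ℚ mix x' y'
  mix-mono x≤x' y≤y' = ℚ.+-mono-≤ (*-monoˡ-≤ 0≤1-p x≤x') (*-monoˡ-≤ 0≤p y≤y')

  mix-idem : ∀ x → mix x x ≡ x
  mix-idem = solve 2 (λ p x → (con 1ℚ :- p) :* x :+ p :* x := x) refl p
    where open +-*-Solver

  -- Expected depths after a climb

  expectation-climb-∷ : ∀ φ f c t →
    expectation φ (climb p (f ∷ c) t) ≡ mix (φ (finish (f ∷ c) t)) (expectation φ (climb p c (plugFrame f t)))
  expectation-climb-∷ φ f c t =
    cong ((1ℚ - p) * φ (finish (f ∷ c) t) +_) (expectation-scale φ p (climb p c (plugFrame f t)))

  expectation-climb-[] : ∀ φ t → expectation φ (climb p [] t) ≡ φ t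
  expectation-climb-[] φ t = trans (ℚ.+-identityʳ (1ℚ * φ t)) (ℚ.*-identityˡ (φ t))

  -- A focus without grandparent is never rotated, so head and tail give the same tree.
  expectation-climb-single : ∀ φ f t → expectation φ (climb p (f ∷ []) t) ≡ φ (plugFrame f t)
  expectation-climb-single φ f t = begin
    expectation φ (climb p (f ∷ []) t)
      ≡⟨ expectation-climb-∷ φ f [] t ⟩
    mix (φ (finish (f ∷ []) t)) (expectation φ (climb p [] (plugFrame f t)))
      ≡⟨ cong₂ mix (cong φ (finish-single f t)) (expectation-climb-[] φ (plugFrame f t)) ⟩
    mix (φ (plugFrame f t)) (φ (plugFrame f t))
      ≡⟨ mix-idem (φ (plugFrame f t)) ⟩
    φ (plugFrame f t) ∎
    where open ≡-Reasoning

  -- Allows expectations to be compared outcome by outcome: weights are nonnegative and every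
  -- outcome is again a search tree on the permitted keys. A tail keeps the reassembled tree, so the
  -- hypotheses pass to the recursive call unchanged.
  climb-support : ∀ {b P} c t → Fits b c → P b → BST (plug c t) → AllKeys P (plug c t) →
    All (λ wt → 0ℚ ≤ℚ proj₁ wt × BST (proj₂ wt) × AllKeys P (proj₂ wt)) (climb p c t)
  climb-support []      t _         pb bst keys = (ℚ.nonNegative⁻¹ 1ℚ , bst , keys) ∷ []
  climb-support (f ∷ c) t (hf ∷ hc) pb bst keys =
    (0≤1-p , finish-BST-AllKeys (f ∷ c) t (hf ∷ hc) pb bst keys) ∷
    map⁺ (All.map (λ (0≤w , h) → *-nonNeg 0≤p 0≤w , h) (climb-support c (plugFrame f t) hc pb bst keys))

  -- A key strictly below the focus moves up by exactly one whenever a rotation takes place.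
  climb-depth-below : ∀ {k n} (φ : ℕ → ℚ) c {t} → RootNot k t → Fits k c →
    depth k (plug c t) ≡ suc n →
    expectation (λ t → φ (depth k t)) (climb p c t) ≡ (1ℚ - stay (length c)) * φ n + stay (length c) * φ (suc n)
  climb-depth-below {k} {n} φ [] {t} _ _ eq = begin
    expectation (λ t → φ (depth k t)) (climb p [] t)  ≡⟨ expectation-climb-[] (λ t → φ (depth k t)) t ⟩
    φ (depth k t)                                     ≡⟨ cong φ eq ⟩
    φ (suc n)                                         ≡⟨ solve 2 (λ x y → y := (con 1ℚ :- con 1ℚ) :* x :+ con 1ℚ :* y) refl (φ n) (φ (suc n)) ⟩
    (1ℚ - 1ℚ) * φ n + 1ℚ * φ (suc n)                  ∎
    where
    open ≡-Reasoning
    open +-*-Solver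
  climb-depth-below {k} {n} φ (f ∷ []) {t} _ _ eq = begin
    expectation (λ t → φ (depth k t)) (climb p (f ∷ []) t)  ≡⟨ expectation-climb-single (λ t → φ (depth k t)) f t ⟩
    φ (depth k (plugFrame f t))                             ≡⟨ cong φ eq ⟩
    φ (suc n)                                               ≡⟨ solve 2 (λ x y → y := (con 1ℚ :- con 1ℚ) :* x :+ con 1ℚ :* y) refl (φ n) (φ (suc n)) ⟩
    (1ℚ - 1ℚ) * φ n + 1ℚ * φ (suc n)                        ∎
    where
    open ≡-Reasoning
    open +-*-Solver
  climb-depth-below {k} {n} φ (f ∷ g ∷ c) {t} root (hf ∷ hs) eq = begin
    expectation ψ (climb p (f ∷ g ∷ c) t)
      ≡⟨ expectation-climb-∷ ψ f (g ∷ c) t ⟩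
    mix (ψ (finish (f ∷ g ∷ c) t)) (expectation ψ (climb p (g ∷ c) (plugFrame f t)))
      ≡⟨ cong₂ mix (cong φ (ℕ.suc-injective (trans (finish-depth-below f g c root (hf ∷ hs)) eq)))
                   (climb-depth-below φ (g ∷ c) (plugFrame-rootNot f t hf) hs eq) ⟩
    mix (φ n) ((1ℚ - stay (suc (length c))) * φ n + stay (suc (length c)) * φ (suc n))
      ≡⟨ solve 4 (λ p s x y → (con 1ℚ :- p) :* x :+ p :* ((con 1ℚ :- s) :* x :+ s :* y)
                           := (con 1ℚ :- p :* s) :* x :+ p :* s :* y)
               refl p (stay (suc (length c))) (φ n) (φ (suc n)) ⟩
    (1ℚ - p * stay (suc (length c))) * φ n + p * stay (suc (length c)) * φ (suc n) ∎
    where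
    open ≡-Reasoning
    open +-*-Solver
    ψ : Tree → ℚ
    ψ t = φ (depth k t)

  module _ (k : ℕ) where

    δ : Tree → ℚ
    δ t = ℕtoℚ (depth k t)

    -- Every rotation, at the focus or further up, lifts a key in the focus by at least one, and
    -- some rotation happens with probability `1ℚ - stay (length c)`.
    climb-depth-focus : ∀ c {t} → IsNode t → Fits k c →
      expectation δ (climb p c t) ≤ℚ δ (plug c t) + (stay (length c) - 1ℚ)
    climb-depth-focus [] {t} _ _ = ℚ.≤-reflexive (trans (expectation-climb-[] δ t) (sym (ℚ.+-identityʳ (δ t))))
    climb-depth-focus (f ∷ []) {t} _ _ =
      ℚ.≤-reflexive (trans (expectation-climb-single δ f t) (sym (ℚ.+-identityʳ (δ (plugFrame f t)))))
    climb-depth-focus (f ∷ g ∷ c) {t} root (hf ∷ hs) = begin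
      expectation δ (climb p (f ∷ g ∷ c) t)
        ≡⟨ expectation-climb-∷ δ f (g ∷ c) t ⟩
      mix (δ (finish (f ∷ g ∷ c) t)) (expectation δ (climb p (g ∷ c) (plugFrame f t)))
        ≤⟨ mix-mono finish≤ (climb-depth-focus (g ∷ c) (plugFrame-isNode f t) hs) ⟩
      mix (D - 1ℚ) (D + (stay (suc (length c)) - 1ℚ))
        ≡⟨ solve 3 (λ p s x → (con 1ℚ :- p) :* (x :- con 1ℚ) :+ p :* (x :+ (s :- con 1ℚ))
                             := x :+ (p :* s :- con 1ℚ)) refl p (stay (suc (length c))) D ⟩
      D + (p * stay (suc (length c)) - 1ℚ) ∎
      where
      open ℚ.≤-Reasoning
      open +-*-Solver
      D : ℚ
      D = δ (plug (f ∷ g ∷ c) t)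
      finish≤ : δ (finish (f ∷ g ∷ c) t) ≤ℚ D - 1ℚ
      finish≤ = begin
        δ (finish (f ∷ g ∷ c) t)
          ≡⟨ solve 1 (λ x → x := con 1ℚ :+ x :- con 1ℚ) refl (δ (finish (f ∷ g ∷ c) t)) ⟩
        1ℚ + δ (finish (f ∷ g ∷ c) t) - 1ℚ
          ≡⟨ cong (_- 1ℚ) (ℕtoℚ-suc (depth k (finish (f ∷ g ∷ c) t))) ⟨
        ℕtoℚ (suc (depth k (finish (f ∷ g ∷ c) t))) - 1ℚ
          ≤⟨ ℚ.+-monoˡ-≤ (ℚ.- 1ℚ) (ℕtoℚ-mono-≤ (finish-depth-focus f g c root (hf ∷ hs))) ⟩
        D - 1ℚ ∎

    -- A rotation at the focus itself does not push `k` down. After a tail, which has probability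
    -- `p`, the new focus contains the search for `k`, and `climb-depth-focus` applies with the
    -- shorter context `c`.
    climb-depth-parent : ∀ f c {t} → BST (plug (f ∷ c) t) → ¬ Fit k f → Fits k c →
      expectation δ (climb p (f ∷ c) t) ≤ℚ δ (plug (f ∷ c) t) + p * (stay (length c) - 1ℚ)
    climb-depth-parent f [] {t} _ _ _ =
      ℚ.≤-reflexive (trans (expectation-climb-single δ f t)
        (solve 2 (λ p x → x := x :+ p :* (con 1ℚ :- con 1ℚ)) refl p (δ (plugFrame f t))))
      where open +-*-Solver
    climb-depth-parent f (g ∷ c) {t} bst ¬hf hs = begin
      expectation δ (climb p (f ∷ g ∷ c) t)
        ≡⟨ expectation-climb-∷ δ f (g ∷ c) t ⟩
      mix (δ (finish (f ∷ g ∷ c) t)) (expectation δ (climb p (g ∷ c) (plugFrame f t)))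
        ≤⟨ mix-mono (ℕtoℚ-mono-≤ (finish-depth-parent f g c bst ¬hf hs))
                    (climb-depth-focus (g ∷ c) (plugFrame-isNode f t) hs) ⟩
      mix D (D + (stay (suc (length c)) - 1ℚ))
        ≡⟨ solve 3 (λ p s x → (con 1ℚ :- p) :* x :+ p :* (x :+ (s :- con 1ℚ))
                             := x :+ p :* (s :- con 1ℚ)) refl p (stay (suc (length c))) D ⟩
      D + p * (stay (suc (length c)) - 1ℚ) ∎
      where
      open ℚ.≤-Reasoning
      open +-*-Solver
      D : ℚ
      D = δ (plug (f ∷ g ∷ c) t)

    -- The only case using p² + p ≥ 1: with probability 1 - p the rotation at the focus pushes k
    -- down, while with probability about p² a rotation higher up lifts it.
    climb-depth-grandparent : ∀ f g c {t} → BST (plug (f ∷ g ∷ c) t) → ¬ Fit k g → Fits k c →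
      expectation δ (climb p (f ∷ g ∷ c) t) ≤ℚ δ (plug (f ∷ g ∷ c) t) + stay (suc (suc (length c)))
    climb-depth-grandparent f g c {t} bst ¬hg hs = begin
      expectation δ (climb p (f ∷ g ∷ c) t)
        ≡⟨ expectation-climb-∷ δ f (g ∷ c) t ⟩
      mix (δ (finish (f ∷ g ∷ c) t)) (expectation δ (climb p (g ∷ c) (plugFrame f t)))
        ≤⟨ mix-mono (ℕtoℚ-mono-≤ (finish-depth-grandparent f g c bst ¬hg hs))
                    (climb-depth-parent g c bst ¬hg hs) ⟩
      mix (ℕtoℚ (suc (depth k (plug (f ∷ g ∷ c) t)))) (D + p * (s - 1ℚ))
        ≡⟨ cong (λ x → mix x (D + p * (s - 1ℚ))) (ℕtoℚ-suc (depth k (plug (f ∷ g ∷ c) t))) ⟩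
      mix (1ℚ + D) (D + p * (s - 1ℚ))
        ≡⟨ solve 3 (λ p s x → (con 1ℚ :- p) :* (con 1ℚ :+ x) :+ p :* (x :+ p :* (s :- con 1ℚ))
                             := (x :+ p :* (p :* s) :- (p :* p :+ p)) :+ con 1ℚ) refl p s D ⟩
      D + p * (p * s) - (p * p + p) + 1ℚ
        ≤⟨ ℚ.+-monoʳ-≤ (D + p * (p * s) - (p * p + p)) 1≤p²+p ⟩
      D + p * (p * s) - (p * p + p) + (p * p + p)
        ≡⟨ solve 2 (λ x y → x :- y :+ y := x) refl (D + p * (p * s)) (p * p + p) ⟩
      D + p * (p * s)
        ≤⟨ ℚ.+-monoʳ-≤ D (*-monoˡ-≤ 0≤p (p*stay≤stay (length c))) ⟩
      D + p * stay (suc (length c)) ∎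
      where
      open ℚ.≤-Reasoning
      open +-*-Solver
      D s : ℚ
      D = δ (plug (f ∷ g ∷ c) t)
      s = stay (length c)

    -- The cases follow where the search for `k` leaves the path: at the parent, at the grandparent,
    -- or higher. In the last case a head leaves the depth of `k` alone and a tail leads to the
    -- induction hypothesis, whose error is multiplied by `p` just as `stay` is.
    climb-depth : ∀ c {t} → BST (plug c t) → ¬ Fits k c →
      expectation δ (climb p c t) ≤ℚ δ (plug c t) + stay (length c)
    climb-depth [] _ ¬h = ⊥-elim (¬h [])
    climb-depth (f ∷ []) {t} _ _ = begin
      expectation δ (climb p (f ∷ []) t)  ≡⟨ expectation-climb-single δ f t ⟩
      δ (plugFrame f t)                   ≡⟨ ℚ.+-identityʳ (δ (plugFrame f t)) ⟨
      δ (plugFrame f t) + 0ℚ              ≤⟨ ℚ.+-monoʳ-≤ (δ (plugFrame f t)) (ℚ.nonNegative⁻¹ 1ℚ) ⟩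
      δ (plugFrame f t) + 1ℚ              ∎
      where open ℚ.≤-Reasoning
    climb-depth (f ∷ g ∷ c) {t} bst ¬h with All.all? (Fit? k) (g ∷ c) | All.all? (Fit? k) c | climb-depth (g ∷ c) bst
    ... | yes hs | _ | _ = begin
      expectation δ (climb p (f ∷ g ∷ c) t)
        ≤⟨ climb-depth-parent f (g ∷ c) bst (λ hf → ¬h (hf ∷ hs)) hs ⟩
      D + p * (s - 1ℚ)
        -- The term `- p` is a gain that the bound can afford to discard.
        ≡⟨ solve 3 (λ p s x → x :+ p :* (s :- con 1ℚ) := x :+ p :* s :+ :- p) refl p s D ⟩
      D + p * s + ℚ.- p
        ≤⟨ ℚ.+-monoʳ-≤ (D + p * s) (ℚ.neg-antimono-≤ 0≤p) ⟩
      D + p * s + 0ℚ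
        ≡⟨ ℚ.+-identityʳ (D + p * s) ⟩
      D + p * s ∎
      where
      open ℚ.≤-Reasoning
      open +-*-Solver
      D s : ℚ
      D = δ (plug (f ∷ g ∷ c) t)
      s = stay (suc (length c))
    ... | no ¬hs | yes hc | _ = climb-depth-grandparent f g c bst (λ hg → ¬hs (hg ∷ hc)) hc
    ... | no ¬hs | no ¬hc | ih = begin
      expectation δ (climb p (f ∷ g ∷ c) t)
        ≡⟨ expectation-climb-∷ δ f (g ∷ c) t ⟩
      mix (δ (finish (f ∷ g ∷ c) t)) (expectation δ (climb p (g ∷ c) (plugFrame f t)))
        ≤⟨ mix-mono (ℚ.≤-reflexive (cong ℕtoℚ (finish-depth-above f g c ¬hc))) (ih ¬hs) ⟩
      mix D (D + s)
        ≡⟨ solve 3 (λ p s x → (con 1ℚ :- p) :* x :+ p :* (x :+ s) := x :+ p :* s) refl p s D ⟩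
      D + p * s ∎
      where
      open ℚ.≤-Reasoning
      open +-*-Solver
      D s : ℚ
      D = δ (plug (f ∷ g ∷ c) t)
      s = stay (suc (length c))

    depth-singleton : ∀ b → depth k (node leaf b leaf) ≤ 1
    depth-singleton b with k <ᵇ b | b <ᵇ k
    ... | true  | _     = s≤s z≤n
    ... | false | true  = s≤s z≤n
    ... | false | false = z≤n

    -- The comparison is with the tree before the insertion. If the search for `k` misses the gap,
    -- the new leaf is invisible to it and `climb-depth` suffices. Otherwise the new leaf costs at
    -- most one, which the summand `- 1ℚ` in `climb-depth-focus` repays.
    climb-inserted-depth : ∀ b c → BST (plug c (node leaf b leaf)) →
      expectation δ (climb p c (node leaf b leaf)) ≤ℚ δ (plug c leaf) + stay (length c)
    climb-inserted-depth b c bst with All.all? (Fit? k) c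
    ... | no ¬h = ℚ.≤-trans (climb-depth c bst ¬h)
                    (ℚ.≤-reflexive (cong (λ d → ℕtoℚ d + stay (length c)) (depth-plug-side c _ _ ¬h)))
    ... | yes h = begin
      expectation δ (climb p c v)      ≤⟨ climb-depth-focus c isNode h ⟩
      δ (plug c v) + (s - 1ℚ)          ≤⟨ ℚ.+-monoˡ-≤ (s - 1ℚ) (ℕtoℚ-mono-≤ deeper) ⟩
      ℕtoℚ (suc (depth k (plug c leaf))) + (s - 1ℚ)
                                       ≡⟨ cong (_+ (s - 1ℚ)) (ℕtoℚ-suc (depth k (plug c leaf))) ⟩
      1ℚ + δ (plug c leaf) + (s - 1ℚ)  ≡⟨ solve 2 (λ x s → con 1ℚ :+ x :+ (s :- con 1ℚ) := x :+ s) refl (δ (plug c leaf)) s ⟩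
      δ (plug c leaf) + s              ∎
      where
      open ℚ.≤-Reasoning
      open +-*-Solver
      v : Tree
      v = node leaf b leaf
      s : ℚ
      s = stay (length c)
      deeper : depth k (plug c v) ≤ suc (depth k (plug c leaf))
      deeper rewrite depth-plug c v h | depth-plug c leaf h | sym (ℕ.+-suc (length c) 0) =
        ℕ.+-monoʳ-≤ (length c) (depth-singleton b)

  -- A single insertion and the potential

  insertRebalance-climb : ∀ {b c v} t → insertZ b [] t ≡ (c , v) → insertRebalance p b t ≡ climb p c v
  insertRebalance-climb t eq rewrite eq = refl

  -- Everything later estimates use about one insertion: `ctx` is the path to the gap that receives
  -- `b`, and `P` covers the keys present afterwards.
  record Insertion (P : ℕ → Set) (b : ℕ) (t : Tree) : Set where
    v : Tree
    v = node leaf b leaf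
    field
      ctx       : Ctx
      climbs    : insertRebalance p b t ≡ climb p ctx v
      plug-leaf : plug ctx leaf ≡ t
      fits      : Fits b ctx
      holds     : P b
      bst       : BST (plug ctx v)
      keys      : AllKeys P (plug ctx v)

  insertion : ∀ {P b t} → P b → BST t → AllKeys P t → AllKeys (_≢ b) t → Insertion P b t
  insertion {P} {b} {t} pb bst keys fresh with insertZ-leaf [] t fresh []
  ... | c , eq , refl , hc = record
    { ctx       = c
    ; climbs    = insertRebalance-climb t eq
    ; plug-leaf = refl
    ; fits      = hc
    ; holds     = pb
    ; bst       = plug-BST c hc (λ {Q} → added {Q}) (λ _ → tt , tt , tt , tt) bst
    ; keys      = plug-⊆+b c (λ {Q} → added {Q}) pb keys
    }
    where
    added : node leaf b leaf ⊆+b leaf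
    added pb _ = tt , pb , tt

  -- For `m` below `L` the truncated difference drops by one with probability `stay m`, which pays
  -- for the leading `stay m` exactly. From `L` on both differences vanish, and `stay m` is at most
  -- `stay L` because `stay` is antitone.
  stay-absorbs-growth : ∀ L m →
    stay m + ((1ℚ - stay m) * ℕtoℚ (L ∸ m) + stay m * ℕtoℚ (L ∸ suc m)) ≤ℚ ℕtoℚ (L ∸ m) + stay L
  stay-absorbs-growth L m with m ℕ.<? L
  ... | yes m<L = begin
    s + ((1ℚ - s) * ℕtoℚ (L ∸ m) + s * u)  ≡⟨ cong (λ x → s + ((1ℚ - s) * x + s * u)) L∸m≡ ⟩
    s + ((1ℚ - s) * (1ℚ + u) + s * u)      ≡⟨ solve 2 (λ s u → s :+ ((con 1ℚ :- s) :* (con 1ℚ :+ u) :+ s :* u) := con 1ℚ :+ u) refl s u ⟩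
    1ℚ + u                                 ≡⟨ L∸m≡ ⟨
    ℕtoℚ (L ∸ m)                           ≡⟨ ℚ.+-identityʳ (ℕtoℚ (L ∸ m)) ⟨
    ℕtoℚ (L ∸ m) + 0ℚ                      ≤⟨ ℚ.+-monoʳ-≤ (ℕtoℚ (L ∸ m)) (stay-nonNeg L) ⟩
    ℕtoℚ (L ∸ m) + stay L                  ∎
    where
    open ℚ.≤-Reasoning
    open +-*-Solver
    s u : ℚ
    s = stay m
    u = ℕtoℚ (L ∸ suc m)
    L∸m≡ : ℕtoℚ (L ∸ m) ≡ 1ℚ + u
    L∸m≡ = trans (cong ℕtoℚ (ℕ.+-∸-assoc 1 m<L)) (ℕtoℚ-suc (L ∸ suc m))
  ... | no m≮L rewrite ℕ.m≤n⇒m∸n≡0 (ℕ.≮⇒≥ m≮L) | ℕ.m≤n⇒m∸n≡0 (ℕ.m≤n⇒m≤1+n (ℕ.≮⇒≥ m≮L)) = begin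
    s + ((1ℚ - s) * 0ℚ + s * 0ℚ)  ≡⟨ solve 1 (λ s → s :+ ((con 1ℚ :- s) :* con 0ℚ :+ s :* con 0ℚ) := con 0ℚ :+ s) refl s ⟩
    0ℚ + s                        ≤⟨ ℚ.+-monoʳ-≤ 0ℚ (stay-antimono (ℕ.≮⇒≥ m≮L)) ⟩
    0ℚ + stay L                   ∎
    where
    open ℚ.≤-Reasoning
    open +-*-Solver
    s : ℚ
    s = stay m

  module _ {P : ℕ → Set} {b : ℕ} {t : Tree} (I : Insertion P b t) where
    open Insertion I

    insertRebalance-depth : ∀ k → expectation (δ k) (insertRebalance p b t) ≤ℚ δ k t + stay (length ctx)
    insertRebalance-depth k = begin
      expectation (δ k) (insertRebalance p b t)  ≡⟨ cong (expectation (δ k)) climbs ⟩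
      expectation (δ k) (climb p ctx v)          ≤⟨ climb-inserted-depth k b ctx bst ⟩
      δ k (plug ctx leaf) + stay (length ctx)    ≡⟨ cong (λ t → δ k t + stay (length ctx)) plug-leaf ⟩
      δ k t + stay (length ctx)                  ∎
      where open ℚ.≤-Reasoning

    insertRebalance-mono : ∀ {φ ψ : Tree → ℚ} → (∀ t' → BST t' → AllKeys P t' → φ t' ≤ℚ ψ t') →
      expectation φ (insertRebalance p b t) ≤ℚ expectation ψ (insertRebalance p b t)
    insertRebalance-mono {φ} {ψ} h =
      subst (λ d → expectation φ d ≤ℚ expectation ψ d) (sym climbs)
        (expectation-mono (All.map (λ {wt} (0≤w , bst' , keys') → 0≤w , h (proj₂ wt) bst' keys')
          (climb-support ctx v fits holds bst keys)))

    -- The next key falls beside the new leaf, one deeper than the old gap, and any rotation takes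
    -- that one back. A general `φ` is needed because truncated subtraction is not linear, so the
    -- mean depth alone would not do.
    insertRebalance-depth-next : ∀ {b'} (φ : ℕ → ℚ) → Fits b' ctx → b' ≢ b →
      expectation (λ t' → φ (depth b' t')) (insertRebalance p b t)
        ≡ (1ℚ - stay (length ctx)) * φ (length ctx) + stay (length ctx) * φ (suc (length ctx))
    insertRebalance-depth-next {b'} φ fits' b'≢b =
      trans (cong (expectation (λ t' → φ (depth b' t'))) climbs)
            (climb-depth-below φ ctx (rootNot b'≢b) fits' below)
      where
      depth-v : depth b' v ≡ 1
      depth-v with ℕ.<-cmp b' b
      ... | tri< b'<b _ _ = depth-< leaf leaf b'<b
      ... | tri≈ _ b'≡b _ = ⊥-elim (b'≢b b'≡b)
      ... | tri> _ _ b<b' = depth-> leaf leaf b<b'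
      below : depth b' (plug ctx v) ≡ suc (length ctx)
      below = trans (depth-plug ctx v fits') (trans (cong (length ctx ℕ.+_) depth-v) (ℕ.+-comm (length ctx) 1))

    -- For an absent key, `depth` counts the nodes on its search path, so it measures the depth of
    -- the gap.
    depth-inserted : depth b t ≡ length ctx
    depth-inserted = trans (cong (depth b) (sym plug-leaf))
      (trans (depth-plug ctx leaf fits) (ℕ.+-identityʳ (length ctx)))

    -- The potential depth k t + (L ∸ depth b t), with b the key to be inserted next, grows by at
    -- most stay L: the truncated part pays for the increase of depth k as long as depth b t < L.
    insertRebalance-potential : ∀ {b'} k L r → Fits b' ctx → b' ≢ b →
      expectation (λ t' → δ k t' + (ℕtoℚ (L ∸ depth b' t') + r)) (insertRebalance p b t)
        ≤ℚ δ k t + (ℕtoℚ (L ∸ depth b t) + (stay L + r))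
    insertRebalance-potential {b'} k L r fits' b'≢b = begin
      expectation (λ t' → δ k t' + φ (depth b' t')) (insertRebalance p b t)
        ≡⟨ expectation-+ (δ k) (λ t' → φ (depth b' t')) (insertRebalance p b t) ⟩
      expectation (δ k) (insertRebalance p b t) + expectation (λ t' → φ (depth b' t')) (insertRebalance p b t)
        ≤⟨ ℚ.+-mono-≤ (insertRebalance-depth k) (ℚ.≤-reflexive (insertRebalance-depth-next φ fits' b'≢b)) ⟩
      δ k t + s + ((1ℚ - s) * φ m + s * φ (suc m))
        ≡⟨ solve 5 (λ x s u u' r → x :+ s :+ ((con 1ℚ :- s) :* (u :+ r) :+ s :* (u' :+ r))
                                := x :+ (s :+ ((con 1ℚ :- s) :* u :+ s :* u') :+ r))
                 refl (δ k t) s (ℕtoℚ (L ∸ m)) (ℕtoℚ (L ∸ suc m)) r ⟩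
      δ k t + (s + ((1ℚ - s) * ℕtoℚ (L ∸ m) + s * ℕtoℚ (L ∸ suc m)) + r)
        ≤⟨ ℚ.+-monoʳ-≤ (δ k t) (ℚ.+-monoˡ-≤ r (stay-absorbs-growth L m)) ⟩
      δ k t + (ℕtoℚ (L ∸ m) + stay L + r)
        ≡⟨ cong (δ k t +_) (ℚ.+-assoc (ℕtoℚ (L ∸ m)) (stay L) r) ⟩
      δ k t + (ℕtoℚ (L ∸ m) + (stay L + r))
        ≡⟨ cong (λ i → δ k t + (ℕtoℚ (L ∸ i) + (stay L + r))) depth-inserted ⟨
      δ k t + (ℕtoℚ (L ∸ depth b t) + (stay L + r)) ∎
      where
      open ℚ.≤-Reasoning
      open +-*-Solver
      m : ℕ
      m = length ctx
      s : ℚ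
      s = stay m
      φ : ℕ → ℚ
      φ d = ℕtoℚ (L ∸ d) + r

  -- Summation over a finger sequence

  overhead : ℕ → List ℕ → ℚ
  -- The last insertion has no next key to carry a potential; its cost is bounded crudely by one.
  overhead L []        = 1ℚ
  overhead L (_ ∷ suf) = stay L + overhead L suf

  overhead-length : ∀ L suf → overhead L suf ≡ ℕtoℚ (length suf) * stay L + 1ℚ
  overhead-length L []        = solve 1 (λ s → con 1ℚ := con 0ℚ :* s :+ con 1ℚ) refl (stay L)
    where open +-*-Solver
  overhead-length L (_ ∷ suf) = begin
    stay L + overhead L suf                         ≡⟨ cong (stay L +_) (overhead-length L suf) ⟩
    stay L + (ℕtoℚ (length suf) * stay L + 1ℚ)    ≡⟨ solve 2 (λ s n → s :+ (n :* s :+ con 1ℚ) := (con 1ℚ :+ n) :* s :+ con 1ℚ) refl (stay L) (ℕtoℚ (length suf)) ⟩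
    (1ℚ + ℕtoℚ (length suf)) * stay L + 1ℚ        ≡⟨ cong (λ n → n * stay L + 1ℚ) (ℕtoℚ-suc (length suf)) ⟨
    ℕtoℚ (suc (length suf)) * stay L + 1ℚ         ∎
    where
    open ≡-Reasoning
    open +-*-Solver

  module _ {xs : List ℕ} (fingerSeq : FingerSeq xs) where
    open FingerSeq fingerSeq

    insert-next : ∀ pre b suf t → xs ≡ pre ++ b ∷ suf → BST t → AllKeys (_∈ pre) t →
      Insertion (_∈ pre ++ b ∷ []) b t
    insert-next pre b suf t eq bst keys =
      insertion (∈-++⁺ʳ pre (here refl)) bst (AllKeys-map ∈-++⁺ˡ t keys)
        (AllKeys-map (λ x∈pre → Unique-++-≢ (subst Unique eq distinct) x∈pre (here refl)) t keys)

    consecutive-≢ : ∀ pre b b' suf → xs ≡ pre ++ b ∷ b' ∷ suf → b' ≢ b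
    consecutive-≢ pre b b' suf eq b'≡b =
      Unique-++-≢ (subst Unique (trans eq (sym (++-assoc pre (b ∷ []) (b' ∷ suf)))) distinct)
        (∈-++⁺ʳ pre (here refl)) (here refl) (sym b'≡b)

    -- The finger condition forbids an earlier key strictly between `b` and `b'`, and distinctness
    -- forbids one equal to `b'`; hence both keys fall into the same gap.
    consecutive-Fits : ∀ pre b b' suf c → xs ≡ pre ++ b ∷ b' ∷ suf → AllKeys (_∈ pre) (plug c leaf) →
      Fits b c → Fits b' c
    consecutive-Fits pre b b' suf c eq keys = Fits-transfer up down c leaf keys
      where
      x≢b' : ∀ {x} → x ∈ pre → x ≢ b'
      x≢b' x∈pre = Unique-++-≢ (subst Unique eq distinct) x∈pre (there (here refl))
      up : ∀ {x} → x ∈ pre → b ℕ.< x → b' ℕ.< x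
      up {x} x∈pre b<x with ℕ.<-cmp b' x
      ... | tri< b'<x _ _ = b'<x
      ... | tri≈ _ b'≡x _ = ⊥-elim (x≢b' x∈pre (sym b'≡x))
      ... | tri> _ _ x<b' = ⊥-elim (finger pre b b' suf eq x x∈pre (inj₁ (b<x , x<b')))
      down : ∀ {x} → x ∈ pre → x ℕ.< b → x ℕ.< b'
      down {x} x∈pre x<b with ℕ.<-cmp x b'
      ... | tri< x<b' _ _ = x<b'
      ... | tri≈ _ x≡b' _ = ⊥-elim (x≢b' x∈pre x≡b')
      ... | tri> _ _ b'<x = ⊥-elim (finger pre b b' suf eq x x∈pre (inj₂ (b'<x , x<b)))

    -- Induction on the remaining keys. Each outcome of the first insertion is bounded by the
    -- potential belonging to the next key, and `insertRebalance-potential` bounds the mean of these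
    -- potentials.
    insertAll-depth : ∀ L k pre b suf t → xs ≡ pre ++ b ∷ suf → BST t → AllKeys (_∈ pre) t →
      expectation (δ k) (insertAll p (b ∷ suf) t) ≤ℚ δ k t + (ℕtoℚ (L ∸ depth b t) + overhead L suf)
    insertAll-depth L k pre b [] t eq bst keys = begin
      expectation (δ k) (bind (insertRebalance p b t) (insertAll p []))
        ≡⟨ expectation-bind (δ k) (insertAll p []) (insertRebalance p b t) ⟩
      expectation (λ t' → expectation (δ k) (insertAll p [] t')) (insertRebalance p b t)
        ≤⟨ insertRebalance-mono I (λ t' _ _ → ℚ.≤-reflexive (expectation-climb-[] (δ k) t')) ⟩
      expectation (δ k) (insertRebalance p b t)
        ≤⟨ insertRebalance-depth I k ⟩
      δ k t + stay (length (Insertion.ctx I))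
        ≤⟨ ℚ.+-monoʳ-≤ (δ k t) (stay-antimono {0} {length (Insertion.ctx I)} z≤n) ⟩
      δ k t + 1ℚ
        ≡⟨ cong (δ k t +_) (ℚ.+-identityˡ 1ℚ) ⟨
      δ k t + (0ℚ + 1ℚ)
        ≤⟨ ℚ.+-monoʳ-≤ (δ k t) (ℚ.+-monoˡ-≤ 1ℚ (ℕtoℚ-nonNeg (L ∸ depth b t))) ⟩
      δ k t + (ℕtoℚ (L ∸ depth b t) + 1ℚ) ∎
      where
      open ℚ.≤-Reasoning
      I : Insertion (_∈ pre ++ b ∷ []) b t
      I = insert-next pre b [] t eq bst keys
    insertAll-depth L k pre b (b' ∷ suf) t eq bst keys = begin
      expectation (δ k) (bind (insertRebalance p b t) (insertAll p (b' ∷ suf)))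
        ≡⟨ expectation-bind (δ k) (insertAll p (b' ∷ suf)) (insertRebalance p b t) ⟩
      expectation (λ t' → expectation (δ k) (insertAll p (b' ∷ suf) t')) (insertRebalance p b t)
        ≤⟨ insertRebalance-mono I (λ t' → insertAll-depth L k (pre ++ b ∷ []) b' suf t'
             (trans eq (sym (++-assoc pre (b ∷ []) (b' ∷ suf))))) ⟩
      expectation (λ t' → δ k t' + (ℕtoℚ (L ∸ depth b' t') + overhead L suf)) (insertRebalance p b t)
        ≤⟨ insertRebalance-potential I k L (overhead L suf) fits' (consecutive-≢ pre b b' suf eq) ⟩
      δ k t + (ℕtoℚ (L ∸ depth b t) + (stay L + overhead L suf)) ∎
      where
      open ℚ.≤-Reasoning
      I : Insertion (_∈ pre ++ b ∷ []) b t
      I = insert-next pre b (b' ∷ suf) t eq bst keys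
      open Insertion I using (ctx; plug-leaf; fits)
      fits' : Fits b' ctx
      fits' = consecutive-Fits pre b b' suf ctx eq (subst (AllKeys (_∈ pre)) (sym plug-leaf) keys) fits

  -- Exponential decay of `stay` and the final constants

  stay-+ : ∀ m n → stay (suc (m ℕ.+ n)) ≡ stay (suc m) * stay (suc n)
  stay-+ zero    n = sym (ℚ.*-identityˡ (stay (suc n)))
  stay-+ (suc m) n = trans (cong (p *_) (stay-+ m n)) (sym (ℚ.*-assoc p (stay (suc m)) (stay (suc n))))

  -- Bernoulli's inequality for p⁻ᵐ, multiplied by pᵐ = stay (suc m).
  stay-bernoulli : ∀ m → stay (suc m) * (1ℚ + ℕtoℚ m * (1ℚ - p)) ≤ℚ 1ℚ
  stay-bernoulli zero    = ℚ.≤-reflexive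
    (solve 1 (λ p → con 1ℚ :* (con 1ℚ :+ con 0ℚ :* (con 1ℚ :- p)) := con 1ℚ) refl p)
    where open +-*-Solver
  stay-bernoulli (suc m) = begin
    p * s * (1ℚ + ℕtoℚ (suc m) * (1ℚ - p))
      ≡⟨ cong (λ x → p * s * (1ℚ + x * (1ℚ - p))) (ℕtoℚ-suc m) ⟩
    p * s * (1ℚ + (1ℚ + n) * (1ℚ - p))
      ≡⟨ solve 3 (λ p s n → p :* s :* (con 1ℚ :+ (con 1ℚ :+ n) :* (con 1ℚ :- p))
                         := s :* (con 1ℚ :+ n :* (con 1ℚ :- p))
                            :- s :* ((con 1ℚ :+ n) :* ((con 1ℚ :- p) :* (con 1ℚ :- p)))) refl p s n ⟩
    s * (1ℚ + n * (1ℚ - p)) - s * ((1ℚ + n) * ((1ℚ - p) * (1ℚ - p)))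
      ≤⟨ ℚ.+-mono-≤ (stay-bernoulli m) (ℚ.neg-antimono-≤ (*-nonNeg (stay-nonNeg (suc m))
           (*-nonNeg (ℚ.≤-trans (ℕtoℚ-nonNeg (suc m)) (ℚ.≤-reflexive (ℕtoℚ-suc m))) (*-nonNeg 0≤1-p 0≤1-p)))) ⟩
    1ℚ + 0ℚ ∎
    where
    open ℚ.≤-Reasoning
    open +-*-Solver
    s n : ℚ
    s = stay (suc m)
    n = ℕtoℚ m

  module _ (K : ℕ) (1≤K[1-p] : 1ℚ ≤ℚ ℕtoℚ K * (1ℚ - p)) where

    -- Bernoulli's inequality with `K * (1 - p)` at least one: `K` further tails at least halve the
    -- probability of reaching the top.
    stay-half : ℕtoℚ 2 * stay (suc K) ≤ℚ 1ℚ
    stay-half = begin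
      ℕtoℚ 2 * stay (suc K)                      ≡⟨ ℚ.*-comm (ℕtoℚ 2) (stay (suc K)) ⟩
      stay (suc K) * (1ℚ + 1ℚ)                   ≤⟨ *-monoˡ-≤ (stay-nonNeg (suc K)) (ℚ.+-monoʳ-≤ 1ℚ 1≤K[1-p]) ⟩
      stay (suc K) * (1ℚ + ℕtoℚ K * (1ℚ - p))    ≤⟨ stay-bernoulli K ⟩
      1ℚ                                         ∎
      where open ℚ.≤-Reasoning

    stay-halves : ∀ l → ℕtoℚ (2 ℕ.^ l) * stay (suc (K ℕ.* l)) ≤ℚ 1ℚ
    stay-halves zero rewrite ℕ.*-zeroʳ K = ℚ.≤-refl
    stay-halves (suc l) = begin
      ℕtoℚ (2 ℕ.* 2 ℕ.^ l) * stay (suc (K ℕ.* suc l))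
        ≡⟨ cong₂ _*_ (ℕtoℚ-* 2 (2 ℕ.^ l)) (trans (cong (λ i → stay (suc i)) (ℕ.*-suc K l)) (stay-+ K (K ℕ.* l))) ⟩
      ℕtoℚ 2 * ℕtoℚ (2 ℕ.^ l) * (stay (suc K) * stay (suc (K ℕ.* l)))
        ≡⟨ solve 4 (λ a b c d → a :* b :* (c :* d) := (a :* c) :* (b :* d)) refl
             (ℕtoℚ 2) (ℕtoℚ (2 ℕ.^ l)) (stay (suc K)) (stay (suc (K ℕ.* l))) ⟩
      ℕtoℚ 2 * stay (suc K) * (ℕtoℚ (2 ℕ.^ l) * stay (suc (K ℕ.* l)))
        ≤⟨ *-monoˡ-≤ (*-nonNeg (ℕtoℚ-nonNeg 2) (stay-nonNeg (suc K))) (stay-halves l) ⟩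
      ℕtoℚ 2 * stay (suc K) * 1ℚ
        ≡⟨ ℚ.*-identityʳ (ℕtoℚ 2 * stay (suc K)) ⟩
      ℕtoℚ 2 * stay (suc K)
        ≤⟨ stay-half ⟩
      1ℚ ∎
      where
      open ℚ.≤-Reasoning
      open +-*-Solver

-- The denominator of `q` serves as `K`, since its product with `q` is the numerator, a positive
-- integer.
archimedean : ∀ q → 0ℚ < q → Σ[ K ∈ ℕ ] (1ℚ ≤ℚ ℕtoℚ K * q)
archimedean q@(ℚ.mkℚ (ℤ.+ suc a) d _) _ = suc d , ℚ.toℚᵘ-cancel-≤
  (ℚᵘ.≤-respʳ-≃ (ℚᵘ.≃-sym (ℚ.toℚᵘ-homo-* (ℕtoℚ (suc d)) q)) 1≤)
  where
  1≤ : ℚ.toℚᵘ 1ℚ ℚᵘ.≤ ℚ.toℚᵘ (ℕtoℚ (suc d)) ℚᵘ.* ℚ.toℚᵘ q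
  1≤ rewrite ℕtoℚ-mkℚ (suc d) = ℚᵘ.*≤* (ℤ.+≤+ (ℕ.≤-trans
    (ℕ.≤-reflexive (cong suc (trans (ℕ.+-identityʳ _) (ℕ.+-identityʳ d))))
    (ℕ.≤-trans (ℕ.m≤m*n (suc d) (suc a)) (ℕ.≤-reflexive (sym (ℕ.*-identityʳ _))))))
archimedean (ℚ.mkℚ (ℤ.+ zero) d _)     0<q = ⊥-elim (ℤ.Positive.pos (ℚ.positive 0<q))
archimedean (ℚ.mkℚ (ℤ.-[1+ n ]) d _)  0<q = ⊥-elim (ℤ.Positive.pos (ℚ.positive 0<q))

n<2^[1+⌊log₂n⌋] : ∀ n → n ℕ.< 2 ℕ.^ suc ⌊log₂ n ⌋
n<2^[1+⌊log₂n⌋] n = ℕ.≰⇒> λ 2^≤n →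
  ℕ.1+n≰n (ℕ.≤-trans (ℕ.≤-reflexive (sym (⌊log₂[2^n]⌋≡n (suc ⌊log₂ n ⌋)))) (⌊log₂⌋-mono-≤ 2^≤n))

-- For positive `p`, the condition p² + p > 1 is a rational form of p > (√5 - 1)/2. At least two
-- keys make the logarithm positive, so that a multiple of it can absorb additive constants.
theorem6 : (p : ℚ) → 0ℚ < p → p < 1ℚ → 1ℚ < p * p + p →
    Σ[ C ∈ ℕ ] ((xs : List ℕ) → FingerSeq xs → 2 ≤ length xs →
    (k : ℕ) → k ∈ xs →
    expectedDepth p xs k ≤ℚ ℕtoℚ (C Data.Nat.* ⌊log₂ length xs ⌋))
theorem6 p 0<p p<1 1<p²+p with archimedean (1ℚ - p) 0<1-p
  where
  0<1-p : 0ℚ < 1ℚ - p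
  0<1-p = ℚ.≤-<-trans (ℚ.≤-reflexive (sym (ℚ.+-inverseʳ p))) (ℚ.+-monoˡ-< (ℚ.- p) p<1)
-- With `l` the logarithm, the depth bound `L + 2` below equals `K * l + (K + 3)`, which is at most
-- `(K + (K + 3)) * l` as `l` is at least one.
... | K , 1≤K[1-p] = K ℕ.+ (K ℕ.+ 3) , bound
  where
  open RebalanceZigZag p (ℚ.<⇒≤ 0<p) (ℚ.<⇒≤ p<1) (ℚ.<⇒≤ 1<p²+p)
  bound : (xs : List ℕ) → FingerSeq xs → 2 ≤ length xs → (k : ℕ) → k ∈ xs →
    expectedDepth p xs k ≤ℚ ℕtoℚ ((K ℕ.+ (K ℕ.+ 3)) ℕ.* ⌊log₂ length xs ⌋)
  bound (b ∷ suf) fingerSeq 2≤n k _ = begin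
    expectedDepth p (b ∷ suf) k
      ≤⟨ insertAll-depth fingerSeq L k [] b suf leaf refl tt tt ⟩
    0ℚ + (ℕtoℚ L + overhead L suf)
      ≡⟨ ℚ.+-identityˡ (ℕtoℚ L + overhead L suf) ⟩
    ℕtoℚ L + overhead L suf
      ≡⟨ cong (ℕtoℚ L +_) (overhead-length L suf) ⟩
    ℕtoℚ L + (ℕtoℚ (length suf) * stay L + 1ℚ)
      ≤⟨ ℚ.+-monoʳ-≤ (ℕtoℚ L) (ℚ.+-monoˡ-≤ 1ℚ few) ⟩
    ℕtoℚ L + (1ℚ + 1ℚ)
      ≡⟨ ℕtoℚ-+ L 2 ⟨
    ℕtoℚ (L ℕ.+ 2)
      ≤⟨ ℕtoℚ-mono-≤ L+2≤ ⟩
    ℕtoℚ ((K ℕ.+ (K ℕ.+ 3)) ℕ.* l) ∎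
    where
    open ℚ.≤-Reasoning
    l L : ℕ
    l = ⌊log₂ suc (length suf) ⌋
    -- This makes `stay L` equal to p to the power K(l + 1), hence at most 1/2^(l + 1), while the
    -- number of keys is below 2^(l + 1).
    L = suc (K ℕ.* suc l)
    few : ℕtoℚ (length suf) * stay L ≤ℚ 1ℚ
    few = ℚ.≤-trans
      (*-monoʳ-≤ (stay-nonNeg L)
        (ℕtoℚ-mono-≤ (ℕ.≤-trans (ℕ.n≤1+n _) (ℕ.<⇒≤ (n<2^[1+⌊log₂n⌋] (suc (length suf)))))))
      (stay-halves K 1≤K[1-p] (suc l))
    1≤l : 1 ≤ l
    1≤l = ⌊log₂⌋-mono-≤ 2≤n
    L+2≤ : L ℕ.+ 2 ≤ (K ℕ.+ (K ℕ.+ 3)) ℕ.* l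
    L+2≤ = ℕ.≤-trans (ℕ.≤-reflexive L+2≡) (ℕ.≤-trans
      (ℕ.+-monoʳ-≤ (K ℕ.* l) (ℕ.≤-trans (ℕ.≤-reflexive (sym (ℕ.*-identityʳ (K ℕ.+ 3)))) (ℕ.*-monoʳ-≤ (K ℕ.+ 3) 1≤l)))
      (ℕ.≤-reflexive (sym (ℕ.*-distribʳ-+ l K (K ℕ.+ 3)))))
      where
      open ℕ-Solver
      L+2≡ : L ℕ.+ 2 ≡ K ℕ.* l ℕ.+ (K ℕ.+ 3)
      L+2≡ = solve 2 (λ K l → con 1 :+ K :* (con 1 :+ l) :+ con 2 := K :* l :+ (K :+ con 3)) refl K l
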